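{- Let $P$ be a countable meet-continuous dcpo such that every nonempty upper-bounded subset of $P$ has a supremum in $P$. Then the Scott space $\Sigma P$ is sober. Moreover, finite products of such dcpos satisfy the Scott product equality: if $P_1,\ldots,P_n$ are countable meet-continuous dcpos in each of which every nonempty upper-bounded subset has a supremum, then $\sigma\bigl(\prod_{i=1}^{n}P_i\bigr)=\prod_{i=1}^{n}\sigma(P_i)$. No least element of $P$ (or of the $P_i$) is assumed.
   Context: All posets and directed sets are nonempty; countable sets may be finite. A subset $D$ of a poset is directed if any two of its elements have a common upper bound in $D$. A dcpo is a poset in which every directed subset has a supremum. Write $\mathord{\downarrow}x=\{y:y\le x\}$ and $\mathord{\downarrow}A=\bigcup_{a\in A}\mathord{\downarrow}a$. For a dcpo $P$, an upper set $U\subseteq P$ is Scott open if for every directed $D\subseteq P$, $\bigvee D\in U$ implies $D\cap U\neq\emptyset$; the Scott open sets form the Scott topology $\sigma(P)$, and $\Sigma P=(P,\sigma(P))$ is the Scott space. A dcpo $P$ is meet-continuous if for every $x\in P$ and every directed $D\subseteq P$, $x\le\bigvee D$ implies $x\in\operatorname{cl}_{\sigma(P)}(\mathord{\downarrow}x\cap\mathord{\downarrow}D)$, where $\operatorname{cl}_{\sigma(P)}$ is closure in the Scott topology. A nonempty Scott-closed set $A$ is irreducible if any two open sets meeting $A$ have an intersection meeting $A$. $\Sigma P$ is sober if each irreducible closed set $A$ equals $\mathord{\downarrow}a$ for a unique $a\in P$. $\prod_i P_i$ carries the coordinatewise order, $\sigma(\prod_i P_i)$ is its Scott topology, and $\prod_i\sigma(P_i)$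 denotes the ordinary topological product of the Scott topologies. -}

module Defs where

open import Data.Fin.Base using (Fin)
open import Data.Nat.Base using (ℕ)
open import Data.Product using (∃; ∃-syntax; ∃!; Σ-syntax; _×_)
open import Function.Bundles using (Injection)
open import Level using (_⊔_; suc)
open import Relation.Binary.Bundles using (Poset)
open import Relation.Binary.PropositionalEquality.Properties using (setoid)
open import Relation.Unary using (Pred; _∈_; _⊆_; _∩_; _≐_; _≬_; ∁; Satisfiable)

-- A topology on X is given by its collection of
-- open subsets, i.e. a predicate on subsets.

module _ {x ℓ o} {X : Set x} (Open : Pred (Pred X ℓ) o) where

  Closed : Pred (Pred X ℓ) o
  Closed A = Open (∁ A)

  Closure : ∀ {a} → Pred X a → Pred X (x ⊔ suc ℓ ⊔ o ⊔ a)
  Closure A y = ∀ C → Closed C → A ⊆ C → y ∈ C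

  IrreducibleClosed : Pred (Pred X ℓ) (x ⊔ suc ℓ ⊔ o)
  IrreducibleClosed A =
    Closed A × Satisfiable A ×
    (∀ U V → Open U → Open V → A ≬ U → A ≬ V → A ≬ (U ∩ V))

-- The topology whose basis is the boxes ∏ V i with every V i open; since
-- the index set is finite, this is the product topology.

ProductTopology : ∀ {x ℓ o n} {X : Fin n → Set x}
                → (∀ i → Pred (Pred (X i) ℓ) o)
                → Pred (Pred (∀ i → X i) ℓ) (x ⊔ suc ℓ ⊔ o)
ProductTopology {ℓ = ℓ} {X = X} Open U =
  ∀ x → x ∈ U →
  Σ[ V ∈ (∀ i → Pred (X i) ℓ) ]
         ((∀ i → Open i (V i)) × (∀ i → x i ∈ V i) ×
          (∀ y → (∀ i → y i ∈ V i) → y ∈ U))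

-- Suprema are expressed relationally and are
-- unique up to the equality _≈_ of the poset.

module _ {c ℓ₁ ℓ₂} (P : Poset c ℓ₁ ℓ₂) where

  open Poset P

  -- A single universe level for subsets; it is high enough for all
  -- levels used by P and is the same for P and for finite products of
  -- posets of these levels.
  Subset : Set (suc (c ⊔ ℓ₁ ⊔ ℓ₂))
  Subset = Pred Carrier (c ⊔ ℓ₁ ⊔ ℓ₂)

  Countable : Set (c ⊔ ℓ₁)
  Countable = Injection Eq.setoid (setoid ℕ)

  UpperBound : Subset → Pred Carrier (c ⊔ ℓ₁ ⊔ ℓ₂)
  UpperBound A b = ∀ a → a ∈ A → a ≤ b

  Supremum : Subset → Pred Carrier (c ⊔ ℓ₁ ⊔ ℓ₂)
  Supremum A s = UpperBound A s × (∀ b → UpperBound A b → s ≤ b)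

  Directed : Pred Subset (c ⊔ ℓ₁ ⊔ ℓ₂)
  Directed D =
    Satisfiable D ×
    (∀ a b → a ∈ D → b ∈ D → ∃[ d ] (d ∈ D × a ≤ d × b ≤ d))

  IsDcpo : Set (suc (c ⊔ ℓ₁ ⊔ ℓ₂))
  IsDcpo = ∀ D → Directed D → ∃[ s ] Supremum D s

  HasBoundedSuprema : Set (suc (c ⊔ ℓ₁ ⊔ ℓ₂))
  HasBoundedSuprema =
    ∀ A → Satisfiable A → ∃ (UpperBound A) → ∃[ s ] Supremum A s

  ↓ : Carrier → Pred Carrier ℓ₂
  ↓ x y = y ≤ x

  ↓ˢ : Subset → Subset
  ↓ˢ A y = ∃[ a ] (a ∈ A × y ∈ ↓ a)

  IsUpperSet : Pred Subset (c ⊔ ℓ₁ ⊔ ℓ₂)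
  IsUpperSet U = ∀ x y → x ≤ y → x ∈ U → y ∈ U

  ScottOpen : Pred Subset (suc (c ⊔ ℓ₁ ⊔ ℓ₂))
  ScottOpen U =
    IsUpperSet U × (∀ D → Directed D → ∀ s → Supremum D s → s ∈ U → D ≬ U)

  IsMeetContinuous : Set (suc (c ⊔ ℓ₁ ⊔ ℓ₂))
  IsMeetContinuous =
    ∀ x D → Directed D → ∀ s → Supremum D s → x ≤ s →
    x ∈ Closure ScottOpen (↓ x ∩ ↓ˢ D)

  IsScottSober : Set (suc (c ⊔ ℓ₁ ⊔ ℓ₂))
  IsScottSober =
    ∀ A → IrreducibleClosed ScottOpen A → ∃! _≈_ (λ a → A ≐ ↓ a)

ΠPoset : ∀ {c ℓ₁ ℓ₂ n} → (Fin n → Poset c ℓ₁ ℓ₂) → Poset c ℓ₁ ℓ₂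
ΠPoset P = record
  { Carrier = ∀ i → Poset.Carrier (P i)
  ; _≈_ = λ x y → ∀ i → Poset._≈_ (P i) (x i) (y i)
  ; _≤_ = λ x y → ∀ i → Poset._≤_ (P i) (x i) (y i)
  ; isPartialOrder = record
    { isPreorder = record
      { isEquivalence = record
        { refl  = λ i → Poset.Eq.refl (P i)
        ; sym   = λ p i → Poset.Eq.sym (P i) (p i)
        ; trans = λ p q i → Poset.Eq.trans (P i) (p i) (q i)
        }
      ; reflexive = λ p i → Poset.reflexive (P i) (p i)
      ; trans     = λ p q i → Poset.trans (P i) (p i) (q i)
      }
    ; antisym = λ p q i → Poset.antisym (P i) (p i) (q i)
    }
  }

{-# OPTIONS --safe #-}
module Submission where

open import Defs
open import Axiom.ExcludedMiddle using (ExcludedMiddle)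
open import Data.Fin.Base using (Fin; zero; suc)
open import Data.Fin.Properties using (_≟_)
open import Data.Nat.Base as ℕ using (ℕ; zero; suc; _+_; _⊔_)
import Data.Nat.Properties as ℕ
open import Data.Product.Base using (Σ-syntax; ∃; ∃-syntax; _×_; _,_; proj₁; proj₂)
open import Data.Sum.Base using (_⊎_; inj₁; inj₂)
open import Data.Unit.Base using (⊤)
open import Function.Bundles using (Injection)
open import Level using (Lift; lift; lower)
open import Relation.Binary.Bundles using (Poset)
open import Relation.Binary.PropositionalEquality.Core
  using (_≡_; _≢_; refl; sym; cong; subst)
open import Relation.Nullary.Decidable.Core using (yes; no; decidable-stable)
open import Relation.Nullary.Negation.Core using (¬_; contradiction)
open import Relation.Unary using (Pred; _∈_; _⊆_; _≐_; _≬_; ∁; Satisfiable)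

-- The key point is that the Scott topology has a basis of open filters.  Given
-- x in a Scott open set U, let y₀ = x ≥ y₁ ≥ y₂ ≥ … be a sequence in U that is
-- generic for countably many dense sets, and let F be the filter it generates.
-- Suppose D is directed with supremum in F.  By meet-continuity, some element
-- of U lies below both y n and a member of D, for every n.
--  * If for some d ∈ D and k the inequality y k ≤ d ∨ z holds for all z ∈ U far
--    down the sequence, then choosing z below a member of D gives d'' ∈ D above
--    d and z, hence above y k.
--  * Otherwise, by genericity, one finds l₀ < l₁ < …, d₀ ≤ d₁ ≤ … in D and
--    zᵢ ∈ U below y lᵢ and dᵢ such that y lᵢ ≰ dᵢ ∨ y lᵢ₊₁.  The supremum e of
--    all zᵢ lies in F by genericity, so y lᵢ ≤ e for large i; but
--    e ≤ dᵢ ∨ y lᵢ₊₁, a contradiction.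
-- An open filter in a finite product is a box, which gives the product
-- equality.  Sobriety follows from the case P × P: if A is irreducible closed,
-- then the set of pairs without an upper bound in A is Scott open, so it
-- contains a box around each of its points, and irreducibility makes A directed.

-- Enumerating pairs and finite tuples of natural numbers.

next : ℕ × ℕ → ℕ × ℕ
next (a , zero)  = zero , suc a
next (a , suc b) = suc a , b

unpair : ℕ → ℕ × ℕ
unpair zero    = zero , zero
unpair (suc n) = next (unpair n)

-- `next` walks each antidiagonal from (0, s) to (s, 0) and then enters the following one. The proof
-- runs this walk backwards, by recursion on `s` and then on `a`.
unpair-surjective : ∀ a b → ∃[ n ] unpair n ≡ (a , b)
unpair-surjective a b = onDiagonal (a + b) a b refl
  where
  onDiagonal : ∀ s a b → a + b ≡ s → ∃[ n ] unpair n ≡ (a , b)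
  onDiagonal s (suc a) b eq
    with n , e ← onDiagonal s a (suc b) (subst (_≡ s) (sym (ℕ.+-suc a b)) eq)
    = suc n , cong next e
  onDiagonal zero zero zero eq = zero , refl
  onDiagonal (suc s) zero (suc b) eq
    with n , e ← onDiagonal s b zero (subst (_≡ s) (sym (ℕ.+-identityʳ b)) (ℕ.suc-injective eq))
    = suc n , cong next e

decode : ∀ {n} → ℕ → Fin n → ℕ
decode m zero    = proj₁ (unpair m)
decode m (suc i) = decode (proj₂ (unpair m)) i

decode-surjective : ∀ {n} (f : Fin n → ℕ) → ∃[ m ] (∀ i → decode m i ≡ f i)
decode-surjective {zero}  f = zero , λ ()
decode-surjective {suc n} f
  with k , eq ← decode-surjective (λ i → f (suc i))
  with m , e ← unpair-surjective (f zero) k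
  = m , λ where
      zero    → cong proj₁ e
      (suc i) → subst (λ t → decode (proj₂ t) i ≡ f (suc i)) (sym e) (eq i)

-- Changing one coordinate of a tuple.

module _ {a n} {A : Fin n → Set a} where

  override : (∀ j → A j) → ∀ i → A i → ∀ j → A j
  override x i v j with i ≟ j
  ... | yes refl = v
  ... | no  _    = x j

  override-at : ∀ x i v → override x i v i ≡ v
  override-at x i v with i ≟ i
  ... | yes refl = refl
  ... | no  i≢i  = contradiction refl i≢i

  override-elim : ∀ {q} (Q : ∀ j → A j → Set q) x i v →
                  Q i v → (∀ j → i ≢ j → Q j (x j)) → ∀ j → Q j (override x i v j)
  override-elim Q x i v qv qx j with i ≟ j
  ... | yes refl = qv
  ... | no  i≢j  = qx j i≢j

  override-≢ : ∀ x i v j → i ≢ j → override x i v j ≡ x j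
  override-≢ x i v j i≢j with i ≟ j
  ... | yes i≡j = contradiction i≡j i≢j
  ... | no  _   = refl

-- Enumerations, open filters and directed images.

module _ {c ℓ₁ ℓ₂} (P : Poset c ℓ₁ ℓ₂) where

  open Poset P

  Enumeration : Set _
  Enumeration = Σ[ e ∈ (ℕ → Carrier) ] (∀ p → ∃[ n ] e n ≈ p)

  -- Meet-continuity with the closure unfolded: no open set containing x misses
  -- ↓ x ∩ ↓ D.
  Approximating : Set _
  Approximating = ∀ U → ScottOpen P U → ∀ x → x ∈ U →
    ∀ D → Directed P D → ∀ s → Supremum P D s → x ≤ s →
    ∃[ z ] (z ∈ U × z ≤ x × z ∈ ↓ˢ P D)

  Filtered : Pred (Subset P) _
  Filtered F = ∀ a b → a ∈ F → b ∈ F → ∃[ z ] (z ∈ F × z ≤ a × z ≤ b)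

  OpenFilterBasis : Set _
  OpenFilterBasis = ∀ U → ScottOpen P U → ∀ x → x ∈ U →
    ∃[ F ] (ScottOpen P F × Filtered F × x ∈ F × F ⊆ U)

module _ {c ℓ₁ ℓ₂} {P Q : Poset c ℓ₁ ℓ₂} where

  private
    module P = Poset P
    module Q = Poset Q

  image : (P.Carrier → Q.Carrier) → Subset P → Subset Q
  image f D q = ∃[ p ] (p ∈ D × (Lift ℓ₁ (Lift ℓ₂ (f p ≡ q))))

  ∈-image : ∀ f {D p} → p ∈ D → f p ∈ image f D
  ∈-image f p∈D = _ , p∈D , lift (lift refl)

  image-directed : ∀ f → (∀ {x y} → x P.≤ y → f x Q.≤ f y) →
                   ∀ {D} → Directed P D → Directed Q (image f D)
  image-directed f mono ((p , p∈D) , dir) = (f p , ∈-image f p∈D) , λ where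
    _ _ (a , a∈D , lift (lift refl)) (b , b∈D , lift (lift refl)) →
      let d , d∈D , a≤d , b≤d = dir a b a∈D b∈D
      in f d , ∈-image f d∈D , mono a≤d , mono b≤d

-- Classical forms of countability and meet-continuity.

module Classical (em : ∀ a → ExcludedMiddle a) where

  ¬¬-elim : ∀ {a} {A : Set a} → ¬ ¬ A → A
  ¬¬-elim = decidable-stable (em _)

  module _ {c ℓ₁ ℓ₂} (P : Poset c ℓ₁ ℓ₂) where

    open Poset P renaming (refl to ≤-refl; trans to ≤-trans)

    enumerate : Carrier → Countable P → Enumeration P
    enumerate p₀ inj = e , λ p → Injection.to inj p , e-code p
      where
      e : ℕ → Carrier
      e n with em _ {∃[ p ] Injection.to inj p ≡ n}
      ... | yes (p , _) = p
      -- Numbers outside the range of the injection get a default value; this is where nonemptiness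
      -- enters.
      ... | no  _       = p₀
      e-code : ∀ p → e (Injection.to inj p) ≈ p
      e-code p with em _ {∃[ q ] Injection.to inj q ≡ Injection.to inj p}
      ... | yes (q , eq) = Injection.injective inj eq
      ... | no  none     = contradiction (p , refl) none

    -- `Closed (∁ U)` unfolds to openness of this double complement.
    ∁∁-open : ∀ {U} → ScottOpen P U → ScottOpen P (∁ (∁ U))
    ∁∁-open (upper , inacc) =
      (λ x y x≤y x∈ y∉ → x∈ (λ x∈U → y∉ (upper x y x≤y x∈U))) ,
      λ D dir s sup s∈ →
        let d , d∈D , d∈U = inacc D dir s sup (¬¬-elim s∈)
        in d , d∈D , λ d∉ → d∉ d∈U

    -- If no such element existed, `∁ U` would be a closed set containing `↓ x ∩ ↓ˢ D`, hence
    -- containing `x` by meet-continuity.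
    approximating : IsMeetContinuous P → Approximating P
    approximating mc U U-open x x∈U D dir s sup x≤s =
      ¬¬-elim λ none →
        mc x D dir s sup x≤s (∁ U) (∁∁-open U-open)
          (λ { {z} (z≤x , z∈↓D) z∈U → none (z , z∈U , z≤x , z∈↓D) }) x∈U

    -- The open filter generated by a generic descending sequence.

    module GenericFilter
      (enum : Enumeration P) (bounded : HasBoundedSuprema P) (approx : Approximating P)
      (U : Subset P) (U-open : ScottOpen P U) (x : Carrier) (x∈U : x ∈ U) where

      private
        e = proj₁ enum

      -- This is q ≰ p ∨ z, except that the join p ∨ z need not exist.
      Separates : Carrier → Carrier → Pred Carrier _
      Separates p q z = ∃[ b ] (p ≤ b × z ≤ b × ¬ q ≤ b)

      -- Both families of tasks share the index set of pairs, so that one walk through it treats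
      -- them all; first component zero is reserved for the tasks with a single parameter.
      Requirement : ℕ × ℕ → Pred Carrier (c Level.⊔ ℓ₂)
      Requirement (zero  , j) z = Lift c (z ≤ e j)
      Requirement (suc i , j) z = Separates (e i) (e j) z

      Refines : ∀ {r} → Pred Carrier r → Carrier → Pred Carrier _
      Refines R y z = z ∈ U × z ≤ y × z ∈ R

      refine : ∀ {r} → Pred Carrier r → Carrier → Carrier
      refine R y with em _ {∃[ z ] Refines R y z}
      ... | yes (z , _) = z
      -- Staying at `y` is harmless: no element of `U` further down can lie in `R` either.
      ... | no  _       = y

      refine-∈ : ∀ {r} (R : Pred Carrier r) {y} → y ∈ U → refine R y ∈ U
      refine-∈ R {y} y∈U with em _ {∃[ z ] Refines R y z}
      ... | yes (_ , z∈U , _) = z∈U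
      ... | no  _             = y∈U

      refine-≤ : ∀ {r} (R : Pred Carrier r) y → refine R y ≤ y
      refine-≤ R y with em _ {∃[ z ] Refines R y z}
      ... | yes (_ , _ , z≤y , _) = z≤y
      ... | no  _                 = ≤-refl

      refine-decides : ∀ {r} (R : Pred Carrier r) y →
                       refine R y ∈ R ⊎ (∀ z → z ∈ U → z ≤ y → ¬ z ∈ R)
      refine-decides R y with em _ {∃[ z ] Refines R y z}
      ... | yes (_ , _ , _ , z∈R) = inj₁ z∈R
      ... | no  none = inj₂ λ z z∈U z≤y z∈R → none (z , z∈U , z≤y , z∈R)

      y : ℕ → Carrier
      y zero    = x
      y (suc n) = refine (Requirement (unpair n)) (y n)

      y∈U : ∀ n → y n ∈ U
      y∈U zero    = x∈U
      y∈U (suc n) = refine-∈ (Requirement (unpair n)) (y∈U n)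

      y-antitone : ∀ {m n} → m ℕ.≤ n → y n ≤ y m
      y-antitone m≤n = go (ℕ.≤⇒≤′ m≤n)
        where
        go : ∀ {m n} → m ℕ.≤′ n → y n ≤ y m
        go ℕ.≤′-refl            = ≤-refl
        go (ℕ.≤′-step {n} m≤′n) = ≤-trans (refine-≤ (Requirement (unpair n)) (y n)) (go m≤′n)

      decided : ∀ i j → ∃[ n ] (y n ∈ Requirement (i , j) ⊎
                                (∀ z → z ∈ U → z ≤ y n → ¬ z ∈ Requirement (i , j)))
      decided i j with n , eq ← unpair-surjective i j
        with subst (λ t → y (suc n) ∈ Requirement t ⊎ (∀ z → z ∈ U → z ≤ y n → ¬ z ∈ Requirement t))
               eq (refine-decides (Requirement (unpair n)) (y n))
      -- A task treated at step `n` is fulfilled by `y (suc n)`, whereas its impossibility already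
      -- concerns everything in `U` below `y n`.
      ... | inj₁ met  = suc n , inj₁ met
      ... | inj₂ none = n , inj₂ none

      below-decided : ∀ q → ∃[ n ] (y n ≤ q ⊎ (∀ z → z ∈ U → z ≤ y n → ¬ z ≤ q))
      below-decided q with j , ej≈q ← proj₂ enum q with decided 0 j
      ... | n , inj₁ (lift yn≤) = n , inj₁ (≤-trans yn≤ (reflexive ej≈q))
      ... | n , inj₂ none = n , inj₂ λ z z∈U z≤yn z≤q →
        none z z∈U z≤yn (lift (≤-trans z≤q (reflexive (Eq.sym ej≈q))))

      separation-decided : ∀ p q →
        ∃[ n ] (Separates p q (y n) ⊎ (∀ z → z ∈ U → z ≤ y n → ¬ Separates p q z))
      separation-decided p q
        with i , ei≈p ← proj₂ enum p with j , ej≈q ← proj₂ enum q with decided (suc i) j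
      ... | n , inj₁ (b , ei≤b , yn≤b , ej≰b) = n , inj₁
        (b , ≤-trans (reflexive (Eq.sym ei≈p)) ei≤b , yn≤b ,
         λ q≤b → ej≰b (≤-trans (reflexive ej≈q) q≤b))
      ... | n , inj₂ none = n , inj₂ λ { z z∈U z≤yn (b , p≤b , z≤b , q≰b) →
        none z z∈U z≤yn
          (b , ≤-trans (reflexive ei≈p) p≤b , z≤b ,
           λ ej≤b → q≰b (≤-trans (reflexive (Eq.sym ej≈q)) ej≤b)) }

      F : Subset P
      F p = Lift (c Level.⊔ ℓ₁) (∃[ n ] y n ≤ p)

      F⊆U : F ⊆ U
      F⊆U {p} (lift (n , yn≤p)) = proj₁ U-open (y n) p yn≤p (y∈U n)

      F-upper : IsUpperSet P F
      F-upper p q p≤q (lift (n , yn≤p)) = lift (n , ≤-trans yn≤p p≤q)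

      F-filtered : Filtered P F
      F-filtered a b (lift (m , ym≤a)) (lift (n , yn≤b)) =
        y (m ⊔ n) , lift (m ⊔ n , ≤-refl) ,
        ≤-trans (y-antitone (ℕ.m≤m⊔n m n)) ym≤a ,
        ≤-trans (y-antitone (ℕ.m≤n⊔m m n)) yn≤b

      module _ (D : Subset P) (dir : Directed P D) (s : Carrier) (sup : Supremum P D s)
               (m : ℕ) (ym≤s : y m ≤ s) where

        -- From index `m` on the sequence lies below `s`, so meet-continuity applies at index
        -- `m ⊔ n`.
        common : ∀ n → ∃[ z ] (z ∈ U × z ≤ y n × z ∈ ↓ˢ P D)
        common n =
          let z , z∈U , z≤ , z∈↓D = approx U U-open (y (m ⊔ n)) (y∈U (m ⊔ n)) D dir s sup
                                      (≤-trans (y-antitone (ℕ.m≤m⊔n m n)) ym≤s)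
          in z , z∈U , ≤-trans z≤ (y-antitone (ℕ.m≤n⊔m m n)) , z∈↓D

        -- The first case of the dichotomy: `y k ≤ d ∨ z` is phrased as the absence of a common
        -- upper bound of `d` and `z` that is not above `y k`.
        Unseparated : Set _
        Unseparated = ∃[ d ] (d ∈ D × ∃[ k ] ∃[ n ] (∀ z → z ∈ U → z ≤ y n → ¬ Separates d (y k) z))

        meets-if-unseparated : Unseparated → D ≬ F
        meets-if-unseparated (d , d∈D , k , n , none)
          with z , z∈U , z≤yn , d' , d'∈D , z≤d' ← common n
          with d'' , d''∈D , d≤d'' , d'≤d'' ← proj₂ dir d d' d∈D d'∈D
          -- `d''` bounds both `d` and `z`, so `y k ≰ d''` would be a forbidden separation.
          = d'' , d''∈D , lift (k , ¬¬-elim λ yk≰d'' →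
              none z z∈U z≤yn (d'' , d≤d'' , ≤-trans z≤d' d'≤d'' , yk≰d''))

        module _ (separated : ¬ Unseparated) where

          -- Genericity leaves two alternatives, and the negative one is excluded by `separated`;
          -- hence the sequence itself achieves the separation.
          separate : ∀ d → d ∈ D → ∀ k → ∃[ l ] Separates d (y k) (y l)
          separate d d∈D k with separation-decided d (y k)
          ... | n , inj₁ sep  = n , sep
          ... | n , inj₂ none = contradiction (d , d∈D , k , n , none) separated

          record Stage : Set (c Level.⊔ ℓ₁ Level.⊔ ℓ₂) where
            field
              l    : ℕ
              d z  : Carrier
              d∈D  : d ∈ D
              z∈U  : z ∈ U
              z≤yl : z ≤ y l
              z≤d  : z ≤ d

          open Stage

          initial : Stage
          initial = let z , z∈U , z≤y0 , d , d∈D , z≤d = common 0 in record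
            { l = 0 ; d = d ; z = z ; d∈D = d∈D ; z∈U = z∈U ; z≤yl = z≤y0 ; z≤d = z≤d }

          _≺_ : Stage → Stage → Set _
          S ≺ T = l S ℕ.< l T × d S ≤ d T × Separates (d S) (y (l S)) (y (l T))

          successor : ∀ S → ∃[ T ] S ≺ T
          successor S
            with k , b , d≤b , yk≤b , y≰b ← separate (d S) (d∈D S) (l S)
            -- The new index exceeds `l S`, and it is at least `k`, so that `b`, being above `y k`,
            -- also bounds `y` at the new index.
            with z' , z'∈U , z'≤y , d' , d'∈D , z'≤d' ← common (suc (l S) ⊔ k)
            with d'' , d''∈D , d≤d'' , d'≤d'' ← proj₂ dir (d S) d' (d∈D S) d'∈D
            = record { l = suc (l S) ⊔ k ; d = d'' ; z = z' ; d∈D = d''∈D ; z∈U = z'∈U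
                     ; z≤yl = z'≤y ; z≤d = ≤-trans z'≤d' d'≤d'' } ,
              ℕ.m≤m⊔n (suc (l S)) k , d≤d'' ,
              b , d≤b , ≤-trans (y-antitone (ℕ.m≤n⊔m (suc (l S)) k)) yk≤b , y≰b

          stage : ℕ → Stage
          stage zero    = initial
          stage (suc i) = proj₁ (successor (stage i))

          stage-≺ : ∀ i → stage i ≺ stage (suc i)
          stage-≺ i = proj₂ (successor (stage i))

          stage-mono : ∀ {i j} → i ℕ.≤ j → l (stage i) ℕ.≤ l (stage j) × d (stage i) ≤ d (stage j)
          stage-mono i≤j = go (ℕ.≤⇒≤′ i≤j)
            where
            go : ∀ {i j} → i ℕ.≤′ j → l (stage i) ℕ.≤ l (stage j) × d (stage i) ≤ d (stage j)
            go ℕ.≤′-refl = ℕ.≤-refl , ≤-refl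
            go (ℕ.≤′-step {j} i≤′j) =
              let l≤ , d≤ = go i≤′j ; l< , d≤' , _ = stage-≺ j
              in ℕ.≤-trans l≤ (ℕ.<⇒≤ l<) , ≤-trans d≤ d≤'

          n≤l : ∀ n → n ℕ.≤ l (stage n)
          n≤l zero    = ℕ.z≤n
          n≤l (suc n) = ℕ.≤-<-trans (n≤l n) (proj₁ (stage-≺ n))

          Z : Subset P
          Z p = Lift (c Level.⊔ ℓ₁ Level.⊔ ℓ₂) (∃[ i ] z (stage i) ≡ p)

          Z-sup : ∃[ t ] Supremum P Z t
          Z-sup = bounded Z (_ , lift (0 , refl))
            (x , λ { _ (lift (i , refl)) → ≤-trans (z≤yl (stage i)) (y-antitone {n = l (stage i)} ℕ.z≤n) })

          t : Carrier
          t = proj₁ Z-sup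

          z≤t : ∀ i → z (stage i) ≤ t
          z≤t i = proj₁ (proj₂ Z-sup) _ (lift (i , refl))

          -- The supremum splits at `i`: earlier z's lie below their own d's and so below that of
          -- stage `i`, later ones below `y` at the index of stage `suc i`.
          t≤ : ∀ i b → d (stage i) ≤ b → y (l (stage (suc i))) ≤ b → t ≤ b
          t≤ i b d≤b y≤b = proj₂ (proj₂ Z-sup) b λ { _ (lift (j , refl)) → bound j (ℕ.≤-<-connex j i) }
            where
            bound : ∀ j → j ℕ.≤ i ⊎ i ℕ.< j → z (stage j) ≤ b
            bound j (inj₁ j≤i) =
              ≤-trans (z≤d (stage j)) (≤-trans (proj₂ (stage-mono j≤i)) d≤b)
            bound j (inj₂ i<j) =
              ≤-trans (z≤yl (stage j)) (≤-trans (y-antitone (proj₁ (stage-mono i<j))) y≤b)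

          -- Otherwise, from some `y n` downwards no element of `U` lies below `t`; but the `z` of
          -- stage `n` is such an element, as its index is at least `n`.
          eventually-below-t : ∃[ n ] y n ≤ t
          eventually-below-t with below-decided t
          ... | n , inj₁ yn≤t = n , yn≤t
          ... | n , inj₂ none = contradiction (z≤t n)
            (none _ (z∈U (stage n)) (≤-trans (z≤yl (stage n)) (y-antitone (n≤l n))))

          meets-if-separated : D ≬ F
          meets-if-separated with n , yn≤t ← eventually-below-t
            -- The bound separating stages `n` and `suc n` is above `t`, hence above `y n` and
            -- `y (l (stage n))`, contrary to its choice.
            with b , d≤b , y≤b , y≰b ← proj₂ (proj₂ (stage-≺ n))
            = contradiction (≤-trans (y-antitone (n≤l n)) (≤-trans yn≤t (t≤ n b d≤b y≤b))) y≰b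

        F-meets : D ≬ F
        F-meets with em _ {Unseparated}
        ... | yes unsep = meets-if-unseparated unsep
        ... | no  sep   = meets-if-separated sep

      F-open : ScottOpen P F
      F-open = F-upper , λ { D dir s sup (lift (m , ym≤s)) → F-meets D dir s sup m ym≤s }

    openFilterBasis : Enumeration P → HasBoundedSuprema P → Approximating P → OpenFilterBasis P
    openFilterBasis enum bounded approx U U-open x x∈U =
      F , F-open , F-filtered , lift (0 , ≤-refl) , F⊆U
      where open GenericFilter enum bounded approx U U-open x x∈U

  -- Enumerations and suprema in finite products.

  module _ {c ℓ₁ ℓ₂ n} (P : Fin n → Poset c ℓ₁ ℓ₂) where

    private
      module P i = Poset (P i)
      module Π = Poset (ΠPoset P)

    Π-enumeration : (∀ i → Enumeration (P i)) → Enumeration (ΠPoset P)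
    Π-enumeration enum = e , onto
      where
      e : ℕ → Π.Carrier
      e m i = proj₁ (enum i) (decode m i)
      onto : ∀ p → ∃[ m ] (e m Π.≈ p)
      onto p with m , eq ← decode-surjective (λ i → proj₁ (proj₂ (enum i) (p i)))
        = m , λ i → subst (λ k → P._≈_ i (proj₁ (enum i) k) (p i)) (sym (eq i))
                      (proj₂ (proj₂ (enum i) (p i)))

    π : ∀ i → Subset (ΠPoset P) → Subset (P i)
    π i = image {P = ΠPoset P} {Q = P i} (λ x → x i)

    ∈-π : ∀ i {D x} → x ∈ D → x i ∈ π i D
    ∈-π i = ∈-image {P = ΠPoset P} {Q = P i} (λ x → x i)

    π-directed : ∀ i {D} → Directed (ΠPoset P) D → Directed (P i) (π i D)
    π-directed i = image-directed {P = ΠPoset P} {Q = P i} (λ x → x i) (λ x≤y → x≤y i)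

    coordinatewise-supremum : ∀ {A s} → (∀ i → Supremum (P i) (π i A) (s i)) →
                              Supremum (ΠPoset P) A s
    coordinatewise-supremum sup =
      (λ a a∈A i → proj₁ (sup i) (a i) (∈-π i a∈A)) ,
      λ b ub i → proj₂ (sup i) (b i) λ { _ (a , a∈A , lift (lift refl)) → ub a a∈A i }

    override-mono : ∀ x i {a b} → P._≤_ i a b → override x i a Π.≤ override x i b
    override-mono x i {a} {b} a≤b j with i ≟ j
    ... | yes refl = a≤b
    ... | no  _    = P.refl j

    -- Replacing coordinate `i` of `s` by an upper bound of the projection gives an upper bound of
    -- `A`; leastness of `s` is then read off at `i`.
    π-supremum : ∀ {A s} → Supremum (ΠPoset P) A s → ∀ i → Supremum (P i) (π i A) (s i)
    π-supremum {A} {s} (ub , least) i =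
      (λ { _ (a , a∈A , lift (lift refl)) → ub a a∈A i }) ,
      λ b b-ub → subst (P._≤_ i (s i)) (override-at s i b)
        (least (override s i b)
          (λ a a∈A → override-elim (λ j → P._≤_ j (a j)) s i b
            (b-ub (a i) (∈-π i a∈A)) (λ j _ → ub a a∈A j)) i)

    Π-bounded : (∀ i → HasBoundedSuprema (P i)) → HasBoundedSuprema (ΠPoset P)
    Π-bounded bounded A (a , a∈A) (b , ub) =
      (λ i → proj₁ (sups i)) , coordinatewise-supremum (λ i → proj₂ (sups i))
      where
      sups : ∀ i → ∃ (Supremum (P i) (π i A))
      sups i = bounded i (π i A) (a i , ∈-π i a∈A)
        (b i , λ { _ (x , x∈A , lift (lift refl)) → ub x x∈A i })

  directed-finite : ∀ {c ℓ₁ ℓ₂} (P : Poset c ℓ₁ ℓ₂) (D : Subset P) → Directed P D →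
    ∀ {k} (f : Fin k → Poset.Carrier P) → (∀ i → f i ∈ D) →
    ∃[ d ] (d ∈ D × (∀ i → Poset._≤_ P (f i) d))
  directed-finite P D ((d , d∈D) , _) {zero} f f∈D = d , d∈D , λ ()
  directed-finite P D dir {suc k} f f∈D
    with d , d∈D , f≤d ← directed-finite P D dir (λ i → f (suc i)) (λ i → f∈D (suc i))
    with d' , d'∈D , f₀≤d' , d≤d' ← proj₂ dir (f zero) d (f∈D zero) d∈D
    = d' , d'∈D , λ { zero → f₀≤d' ; (suc i) → Poset.trans P (f≤d i) d≤d' }

  filtered-finite : ∀ {c ℓ₁ ℓ₂} (P : Poset c ℓ₁ ℓ₂) (F : Subset P) → Satisfiable F → Filtered P F →
    ∀ {k} (f : Fin k → Poset.Carrier P) → (∀ i → f i ∈ F) →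
    ∃[ d ] (d ∈ F × (∀ i → Poset._≤_ P d (f i)))
  filtered-finite P F (d , d∈F) filt {zero} f f∈F = d , d∈F , λ ()
  filtered-finite P F sat filt {suc k} f f∈F
    with d , d∈F , d≤f ← filtered-finite P F sat filt (λ i → f (suc i)) (λ i → f∈F (suc i))
    with d' , d'∈F , d'≤f₀ , d'≤d ← filt (f zero) d (f∈F zero) d∈F
    = d' , d'∈F , λ { zero → d'≤f₀ ; (suc i) → Poset.trans P d'≤d (d≤f i) }

  -- Meet-continuity as a statement about suprema.

  module _ {c ℓ₁ ℓ₂} (P : Poset c ℓ₁ ℓ₂) where

    open Poset P renaming (refl to ≤-refl; trans to ≤-trans)

    Meets : Carrier → Subset P → Subset P
    Meets x D z = z ≤ x × z ∈ ↓ˢ P D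

    all-open : ScottOpen P (λ _ → Lift (c Level.⊔ ℓ₁ Level.⊔ ℓ₂) ⊤)
    all-open = (λ _ _ _ _ → _) , λ { D ((d , d∈D) , _) _ _ _ → d , d∈D , _ }

    ≰-open : ∀ b → ScottOpen P (λ z → Lift (c Level.⊔ ℓ₁ Level.⊔ ℓ₂) (¬ z ≤ b))
    ≰-open b =
      (λ { x y x≤y (lift x≰b) → lift λ y≤b → x≰b (≤-trans x≤y y≤b) }) ,
      λ { D dir s sup (lift s≰b) → ¬¬-elim λ none → s≰b (proj₂ sup b λ d d∈D →
            ¬¬-elim λ d≰b → none (d , d∈D , lift d≰b)) }

    module _ (approx : Approximating P) {x D s}
             (dir : Directed P D) (sup : Supremum P D s) (x≤s : x ≤ s) where

      meets-nonempty : Satisfiable (Meets x D)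
      meets-nonempty = let z , _ , z∈ = approx _ all-open x _ D dir s sup x≤s in z , z∈

      -- For an upper bound `b` not above `x`, the open complement of `↓ b` contains `x` and would
      -- therefore contain a member of `Meets x D`.
      meets-supremum : Supremum P (Meets x D) x
      meets-supremum = (λ _ → proj₁) , λ b ub → ¬¬-elim λ x≰b →
        let z , lift z≰b , z∈ = approx _ (≰-open b) x (lift x≰b) D dir s sup x≤s
        in z≰b (ub z z∈)

    -- Two members are bounded by `x`, so their join exists; being least, it stays below `x` and
    -- below a common bound in `D`.
    meets-directed : HasBoundedSuprema P → ∀ {x D} → Directed P D →
                     Satisfiable (Meets x D) → Directed P (Meets x D)
    meets-directed bounded {x} {D} (_ , dir) sat = sat , join
      where
      join : ∀ a b → a ∈ Meets x D → b ∈ Meets x D →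
             ∃[ z ] (z ∈ Meets x D × a ≤ z × b ≤ z)
      join a b (a≤x , d , d∈D , a≤d) (b≤x , d' , d'∈D , b≤d')
        with d'' , d''∈D , d≤d'' , d'≤d'' ← dir d d' d∈D d'∈D
        = z , (below x a≤x b≤x , d'' , d''∈D , below d'' (≤-trans a≤d d≤d'') (≤-trans b≤d' d'≤d'')) ,
          proj₁ z-sup a (lift (inj₁ refl)) , proj₁ z-sup b (lift (inj₂ refl))
        where
        pair : Subset P
        pair p = Lift (c Level.⊔ ℓ₁ Level.⊔ ℓ₂) (p ≡ a ⊎ p ≡ b)
        pair-bound : ∀ u → a ≤ u → b ≤ u → UpperBound P pair u
        pair-bound u a≤u b≤u _ (lift (inj₁ refl)) = a≤u
        pair-bound u a≤u b≤u _ (lift (inj₂ refl)) = b≤u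
        joined : ∃ (Supremum P pair)
        joined = bounded pair (a , lift (inj₁ refl)) (x , pair-bound x a≤x b≤x)
        z : Carrier
        z = proj₁ joined
        z-sup : Supremum P pair z
        z-sup = proj₂ joined
        below : ∀ u → a ≤ u → b ≤ u → z ≤ u
        below u a≤u b≤u = proj₂ z-sup u (pair-bound u a≤u b≤u)

  -- Meet-continuity of finite products and the product equality.

  module _ {c ℓ₁ ℓ₂ n} (P : Fin n → Poset c ℓ₁ ℓ₂) where

    private
      module P i = Poset (P i)
      module Π = Poset (ΠPoset P)

    -- It suffices that `M` is directed with supremum `x`, since `U` then meets `M`. The supremum is
    -- checked coordinatewise, using meet-continuity of the factors.
    Π-approximating : (∀ i → HasBoundedSuprema (P i)) → (∀ i → Approximating (P i)) →
                      Approximating (ΠPoset P)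
    Π-approximating bounded approx U U-open x x∈U D dir s sup x≤s =
      let z , (z≤x , z∈↓D) , z∈U =
            proj₂ U-open M (meets-directed (ΠPoset P) (Π-bounded P bounded) dir (w , w∈M)) x
              (coordinatewise-supremum P M-supremum) x∈U
      in z , z∈U , z≤x , z∈↓D
      where
      M : Subset (ΠPoset P)
      M = Meets (ΠPoset P) x D

      local : ∀ i → Satisfiable (Meets (P i) (x i) (π P i D))
      local i = meets-nonempty (P i) (approx i) (π-directed P i dir) (π-supremum P sup i) (x≤s i)

      w : Π.Carrier
      w i = proj₁ (local i)

      w≤x : w Π.≤ x
      w≤x i = proj₁ (proj₂ (local i))

      w-above : ∀ i → ∃[ a ] (a ∈ D × P._≤_ i (w i) (a i))
      w-above i with q , (a , a∈D , lift (lift a≡q)) , w≤q ← proj₂ (proj₂ (local i))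
        = a , a∈D , subst (P._≤_ i (w i)) (sym a≡q) w≤q

      above : ∃[ d ] (d ∈ D × (∀ i → proj₁ (w-above i) Π.≤ d))
      above = directed-finite (ΠPoset P) D dir (λ i → proj₁ (w-above i))
                (λ i → proj₁ (proj₂ (w-above i)))

      d : Π.Carrier
      d = proj₁ above

      w≤d : w Π.≤ d
      w≤d i = P.trans i (proj₂ (proj₂ (w-above i))) (proj₂ (proj₂ above) i i)

      w∈M : w ∈ M
      w∈M = w≤x , d , proj₁ (proj₂ above) , w≤d

      -- The base point `w` of `M` fills the other coordinates; directedness of `D` puts `w` and `v`
      -- below one member.
      local⊆πM : ∀ i → Meets (P i) (x i) (π P i D) ⊆ π P i M
      local⊆πM i {v} (v≤x , _ , (d' , d'∈D , lift (lift refl)) , v≤d')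
        with d'' , d''∈D , d≤d'' , d'≤d'' ← proj₂ dir d d' (proj₁ (proj₂ above)) d'∈D
        = override w i v ,
          (override-elim (λ j u → P._≤_ j u (x j)) w i v v≤x (λ j _ → w≤x j) ,
           d'' , d''∈D ,
           override-elim (λ j u → P._≤_ j u (d'' j)) w i v (P.trans i v≤d' (d'≤d'' i))
             (λ j _ → P.trans j (w≤d j) (d≤d'' j))) ,
          lift (lift (override-at w i v))

      M-supremum : ∀ i → Supremum (P i) (π P i M) (x i)
      M-supremum i =
        (λ { _ (z , (z≤x , _) , lift (lift refl)) → z≤x i }) ,
        λ b ub → proj₂ (meets-supremum (P i) (approx i) (π-directed P i dir) (π-supremum P sup i) (x≤s i))
                   b (λ v v∈ → ub v (local⊆πM i v∈))

    -- Each coordinate yields its own member of `D`; as there are finitely many, one member lies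
    -- above them all.
    product⊆Scott : ProductTopology (λ i → ScottOpen (P i)) ⊆ ScottOpen (ΠPoset P)
    product⊆Scott {U} boxes =
      (λ x y x≤y x∈U →
        let V , V-open , x∈V , V⊆U = boxes x x∈U
        in V⊆U y λ i → proj₁ (V-open i) (x i) (y i) (x≤y i) (x∈V i)) ,
      inaccessible
      where
      inaccessible : ∀ D → Directed (ΠPoset P) D → ∀ s → Supremum (ΠPoset P) D s → s ∈ U → D ≬ U
      inaccessible D dir s sup s∈U
        with V , V-open , s∈V , V⊆U ← boxes s s∈U
        = let d , d∈D , f≤d = directed-finite (ΠPoset P) D dir (λ i → proj₁ (hit i))
                                (λ i → proj₁ (proj₂ (hit i)))
          in d , d∈D , V⊆U d λ i →
            proj₁ (V-open i) _ (d i) (f≤d i i) (proj₂ (proj₂ (hit i)))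
        where
        hit : ∀ i → ∃[ f ] (f ∈ D × f i ∈ V i)
        hit i with _ , (f , f∈D , lift (lift refl)) , f∈V ←
          proj₂ (V-open i) (π P i D) (π-directed P i dir) (s i) (π-supremum P sup i) (s∈V i)
          = f , f∈D , f∈V

    projection : ∀ i → Subset (ΠPoset P) → Subset (P i)
    projection i F a = Lift ℓ₁ (∃[ f ] (f ∈ F × P._≤_ i (f i) a))

    -- Varying only coordinate `i` of `f` carries `D` to a directed set in the product whose
    -- supremum lies in `F`, so openness of `F` applies there.
    projection-open : ∀ i {F} → ScottOpen (ΠPoset P) F → ScottOpen (P i) (projection i F)
    projection-open i {F} (upper , inacc) =
      (λ { a b a≤b (lift (f , f∈F , fi≤a)) → lift (f , f∈F , P.trans i fi≤a a≤b) }) ,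
      inaccessible
      where
      inaccessible : ∀ D → Directed (P i) D → ∀ s → Supremum (P i) D s →
                     s ∈ projection i F → D ≬ projection i F
      inaccessible D dir s (ub , least) (lift (f , f∈F , fi≤s)) = hit
        (inacc fibre fibre-directed (override f i s) (fibre-ub , fibre-least)
          (upper f _ (override-elim (λ j → P._≤_ j (f j)) f i s fi≤s (λ j _ → P.refl j)) f∈F))
        where
        fibre : Subset (ΠPoset P)
        fibre = image {P = P i} {Q = ΠPoset P} (override f i) D
        fibre-directed : Directed (ΠPoset P) fibre
        fibre-directed = image-directed {P = P i} {Q = ΠPoset P} (override f i) (override-mono P f i) dir
        fibre-ub : UpperBound (ΠPoset P) fibre (override f i s)
        fibre-ub _ (d , d∈D , lift (lift refl)) = override-mono P f i (ub d d∈D)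
        fibre-least : ∀ b → UpperBound (ΠPoset P) fibre b → override f i s Π.≤ b
        fibre-least b b-ub = override-elim (λ j u → P._≤_ j u (b j)) f i s
          (least (b i) λ d d∈D → subst (λ u → P._≤_ i u (b i)) (override-at f i d) (bound d d∈D i))
          -- Away from `i` all members of the fibre agree with `f`, and any `d` in the nonempty `D`
          -- shows `f j` to be below `b j`.
          (λ j i≢j → let d , d∈D = proj₁ dir in
            subst (λ u → P._≤_ j u (b j)) (override-≢ f i d j i≢j) (bound d d∈D j))
          where
          bound : ∀ d → d ∈ D → override f i d Π.≤ b
          bound d d∈D = b-ub _ (∈-image {P = P i} {Q = ΠPoset P} (override f i) d∈D)
        hit : fibre ≬ F → D ≬ projection i F
        hit (_ , (d , d∈D , lift (lift refl)) , g∈F) =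
          d , d∈D , lift (override f i d , g∈F , P.reflexive i (P.Eq.reflexive i (override-at f i d)))

    -- An open filter is the box of its projections: if every `y i` lies above the `i`-th coordinate
    -- of some member, a common lower bound of these members in `F` is below `y`.
    Scott⊆product : OpenFilterBasis (ΠPoset P) →
                    ScottOpen (ΠPoset P) ⊆ ProductTopology (λ i → ScottOpen (P i))
    Scott⊆product basis {U} U-open x x∈U
      with F , F-open , filt , x∈F , F⊆U ← basis U U-open x x∈U
      = (λ i → projection i F) , (λ i → projection-open i F-open) ,
        (λ i → lift (x , x∈F , P.refl i)) ,
        λ y y∈ →
          let f , f∈F , f≤ = filtered-finite (ΠPoset P) F (x , x∈F) filt
                               (λ i → proj₁ (lower (y∈ i))) (λ i → proj₁ (proj₂ (lower (y∈ i))))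
          in F⊆U (proj₁ F-open f y (λ i → P.trans i (f≤ i i) (proj₂ (proj₂ (lower (y∈ i))))) f∈F)

    Scott≐product : (∀ i → P.Carrier i) → (∀ i → Countable (P i)) →
                    (∀ i → IsMeetContinuous (P i)) → (∀ i → HasBoundedSuprema (P i)) →
                    ScottOpen (ΠPoset P) ≐ ProductTopology (λ i → ScottOpen (P i))
    Scott≐product inhabited countable mc bounded =
      Scott⊆product (openFilterBasis (ΠPoset P)
        (Π-enumeration P λ i → enumerate (P i) (inhabited i) (countable i))
        (Π-bounded P bounded)
        (Π-approximating bounded λ i → approximating (P i) (mc i))) ,
      product⊆Scott

  -- Sobriety from the product equality for the square.

  module _ {c ℓ₁ ℓ₂} (P : Poset c ℓ₁ ℓ₂) where

    open Poset P renaming (refl to ≤-refl; trans to ≤-trans)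

    private
      P² : Poset c ℓ₁ ℓ₂
      P² = ΠPoset {n = 2} λ _ → P

    closed-lower : ∀ {A} → Closed (ScottOpen P) A → ∀ {x y} → x ≤ y → y ∈ A → x ∈ A
    closed-lower (upper , _) x≤y y∈A = ¬¬-elim λ x∉A → upper _ _ x≤y x∉A y∈A

    closed-directed-sup : ∀ {A} → Closed (ScottOpen P) A →
      ∀ {D s} → Directed P D → D ⊆ A → Supremum P D s → s ∈ A
    closed-directed-sup (_ , inacc) dir D⊆A sup = ¬¬-elim λ s∉A →
      let d , d∈D , d∉A = inacc _ dir _ sup s∉A in d∉A (D⊆A d∈D)

    BoundedIn : Subset P → Subset P²
    BoundedIn A x = Lift ℓ₁ (∃[ z ] (z ∈ A × (∀ i → x i ≤ z)))

    module _ (dcpo : IsDcpo P) (bounded : HasBoundedSuprema P)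
             {A : Subset P} (A-closed : Closed (ScottOpen P) A) where

      range : (Fin 2 → Carrier) → Subset P
      range x p = Lift (c Level.⊔ ℓ₁ Level.⊔ ℓ₂) (∃[ i ] p ≡ x i)

      range-bound : ∀ x {u} → (∀ i → x i ≤ u) → UpperBound P (range x) u
      range-bound x x≤u _ (lift (i , refl)) = x≤u i

      -- A directed set of pairs bounded in `A` has its supremum bounded in `A`. Arbitrary bounds
      -- need not be coherent, but the joins of the pairs depend monotonically on them, so they form
      -- a directed subset of `A` whose supremum is the required bound.
      unbounded-open : ScottOpen P² (∁ (BoundedIn A))
      unbounded-open =
        (λ { x y x≤y x∉ (lift (z , z∈A , y≤z)) →
             x∉ (lift (z , z∈A , λ i → ≤-trans (x≤y i) (y≤z i))) }) ,
        λ D dir s sup s∉ → ¬¬-elim λ none →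
          s∉ (bounded-sup dir sup λ d d∈D → ¬¬-elim λ d∉ → none (d , d∈D , d∉))
        where
        module _ {D s} (dir : Directed P² D) (sup : Supremum P² D s)
                 (D⊆ : ∀ d → d ∈ D → d ∈ BoundedIn A) where

          joined : ∀ d → d ∈ D → ∃ (Supremum P (range d))
          joined d d∈D = let lift (z , z∈A , d≤z) = D⊆ d d∈D in
            bounded (range d) (d zero , lift (zero , refl)) (z , range-bound d d≤z)

          E : Subset P
          E p = ∃[ d ] (d ∈ D × Supremum P (range d) p)

          E-mono : ∀ {d d' p q} → (∀ i → d i ≤ d' i) →
                   Supremum P (range d) p → Supremum P (range d') q → p ≤ q
          E-mono {d} {d'} d≤d' (_ , least) (ub , _) =
            least _ (range-bound d λ i → ≤-trans (d≤d' i) (ub (d' i) (lift (i , refl))))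

          E-directed : Directed P E
          E-directed =
            (let d , d∈D = proj₁ dir ; p , p-sup = joined d d∈D in p , d , d∈D , p-sup) ,
            λ { p q (d , d∈D , p-sup) (d' , d'∈D , q-sup) →
                let d'' , d''∈D , d≤ , d'≤ = proj₂ dir d d' d∈D d'∈D
                    r , r-sup = joined d'' d''∈D
                in r , (d'' , d''∈D , r-sup) , E-mono d≤ p-sup r-sup , E-mono d'≤ q-sup r-sup }

          E⊆A : E ⊆ A
          E⊆A (d , d∈D , _ , least) =
            let lift (z , z∈A , d≤z) = D⊆ d d∈D
            in closed-lower A-closed (least z (range-bound d d≤z)) z∈A

          bounded-sup : s ∈ BoundedIn A
          bounded-sup =
            let t , t-sup = dcpo E E-directed in
            lift (t , closed-directed-sup A-closed E-directed E⊆A t-sup ,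
              proj₂ sup (λ _ → t) λ d d∈D i →
                let p , p-sup = joined d d∈D
                in ≤-trans (proj₁ p-sup (d i) (lift (i , refl))) (proj₁ t-sup p (d , d∈D , p-sup)))

    sober : ScottOpen P² ⊆ ProductTopology (λ _ → ScottOpen P) →
            IsDcpo P → HasBoundedSuprema P → IsScottSober P
    sober boxes dcpo bounded A (A-closed , A-inhabited , irreducible) =
      t , ((λ {a} → proj₁ t-sup a) , λ a≤t → closed-lower A-closed a≤t t∈A) ,
      λ { {u} (A⊆↓u , ↓u⊆A) → antisym (A⊆↓u t∈A) (proj₁ t-sup u (↓u⊆A ≤-refl)) }
      where
      pair : Carrier → Carrier → Fin 2 → Carrier
      pair a b zero       = a
      pair a b (suc zero) = b

      -- Otherwise a box around the pair consists of pairs unbounded in `A`. Irreducibility gives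
      -- `u` in `A` and in both sides, so the box contains the diagonal pair of `u`, which `u`
      -- itself bounds.
      bounded-in-A : ∀ a b → a ∈ A → b ∈ A → pair a b ∈ BoundedIn A
      bounded-in-A a b a∈A b∈A = ¬¬-elim λ ab∉ →
        let V , V-open , ab∈V , V⊆ = boxes (unbounded-open dcpo bounded A-closed) (pair a b) ab∉
            u , u∈A , u∈V₀ , u∈V₁ = irreducible (V zero) (V (suc zero)) (V-open zero) (V-open (suc zero))
                                (a , a∈A , ab∈V zero) (b , b∈A , ab∈V (suc zero))
        in V⊆ (λ _ → u) (λ { zero → u∈V₀ ; (suc zero) → u∈V₁ }) (lift (u , u∈A , λ _ → ≤-refl))

      A-directed : Directed P A
      A-directed = A-inhabited , λ a b a∈A b∈A →
        let lift (z , z∈A , ab≤z) = bounded-in-A a b a∈A b∈A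
        in z , z∈A , ab≤z zero , ab≤z (suc zero)

      t : Carrier
      t = proj₁ (dcpo A A-directed)

      t-sup : Supremum P A t
      t-sup = proj₂ (dcpo A A-directed)

      t∈A : t ∈ A
      t∈A = closed-directed-sup A-closed A-directed (λ a∈A → a∈A) t-sup

proposition4p3 : (∀ a → ExcludedMiddle a) →
    ∀ {c ℓ₁ ℓ₂} →
    ((P : Poset c ℓ₁ ℓ₂) →
    Poset.Carrier P →
    Countable P →
    IsDcpo P →
    IsMeetContinuous P →
    HasBoundedSuprema P →
    IsScottSober P)
    ×
    ((n : ℕ) (P : Fin n → Poset c ℓ₁ ℓ₂) →
    (∀ i → Poset.Carrier (P i)) →
    (∀ i → Countable (P i)) →
    (∀ i → IsDcpo (P i)) →
    (∀ i → IsMeetContinuous (P i)) →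
    (∀ i → HasBoundedSuprema (P i)) →
    ScottOpen (ΠPoset P) ≐ ProductTopology (λ i → ScottOpen (P i)))
proposition4p3 em =
  (λ P p₀ countable dcpo mc bounded →
    -- The product equality is taken for the constant family of length two.
    sober P
      (proj₁ (Scott≐product (λ _ → P) (λ _ → p₀) (λ _ → countable) (λ _ → mc) (λ _ → bounded)))
      dcpo bounded) ,
  λ n P inhabited countable dcpo mc bounded →
    Scott≐product P inhabited countable mc bounded
  where open Classical em
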